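{- Let $T:\mathbb{Z}_{\ge 0}\to\mathbb{R}$ be a sequence of real numbers. Then $T$ satisfies $$T(mn) = T(m)T(n) + T(m-1)T(n-1) \quad\text{for all integers } m,n\ge 1$$ if and only if $T$ is one of the following five sequences: (1) $T(n)=0$ for all $n\ge 0$; (2) $T(n)=\tfrac12$ for all $n\ge 0$; (3) $T(0)=0$ and $T(2n)=T(2n-1)=n$ for all $n\ge 1$; (4) $T(3n)=T(3n+2)=0$ and $T(3n+1)=1$ for all $n\ge 0$; (5) $T(n)=\tfrac12 n(n+1)$ for all $n\ge 0$. -}

module Defs where

open import Data.Integer using (+_)
open import Data.Nat as ℕ using (ℕ)
import Data.Nat.Properties as ℕ
open import Data.Product using (∃-syntax; _,_; _×_; proj₁; proj₂)
open import Data.Rational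
open import Data.Rational.Properties
open import Data.Rational.Solver using (module +-*-Solver)
open import Relation.Binary.PropositionalEquality
  using (_≡_; refl; sym; trans; cong; subst)

-- Real numbers are Cauchy sequences of rationals, considered up to the
-- equivalence relation _≈ℝ_ (their difference is a null sequence).

IsCauchy : (ℕ → ℚ) → Set
IsCauchy s = ∀ ε → 0ℚ < ε →
  ∃[ N ] (∀ m n → N ℕ.≤ m → N ℕ.≤ n → ∣ s m - s n ∣ < ε)

record ℝ : Set where
  constructor mkℝ
  field
    seq    : ℕ → ℚ
    cauchy : IsCauchy seq

open ℝ public

infix 4 _≈ℝ_

_≈ℝ_ : ℝ → ℝ → Set
x ≈ℝ y = ∀ ε → 0ℚ < ε →
  ∃[ N ] (∀ n → N ℕ.≤ n → ∣ seq x n - seq y n ∣ < ε)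

fromℚ : ℚ → ℝ
fromℚ q = mkℝ (λ _ → q) λ ε 0<ε →
  0 , λ _ _ _ _ → subst (λ z → ∣ z ∣ < ε) (sym (+-inverseʳ q)) 0<ε

fromℕ : ℕ → ℝ
fromℕ n = fromℚ (+ n / 1)

private
  half-pos : ∀ {ε} → 0ℚ < ε → 0ℚ < ½ * ε
  half-pos {ε} 0<ε = subst (_< ½ * ε) (*-zeroʳ ½) (*-monoʳ-<-pos ½ 0<ε)

  half+half : ∀ ε → ½ * ε + ½ * ε ≡ ε
  half+half ε = trans (sym (*-distribʳ-+ ε ½ ½)) (*-identityˡ ε)

  +-cauchy : ∀ {s t} → IsCauchy s → IsCauchy t → IsCauchy (λ n → s n + t n)
  +-cauchy {s} {t} cs ct ε 0<ε = M ℕ.⊔ N , λ m n M⊔N≤m M⊔N≤n → begin-strict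
      ∣ (s m + t m) - (s n + t n) ∣
    ≡⟨ cong ∣_∣ (rearrange (s m) (t m) (s n) (t n)) ⟩
      ∣ (s m - s n) + (t m - t n) ∣
    ≤⟨ ∣p+q∣≤∣p∣+∣q∣ (s m - s n) (t m - t n) ⟩
      ∣ s m - s n ∣ + ∣ t m - t n ∣
    <⟨ +-mono-<
         (proj₂ (cs (½ * ε) (half-pos 0<ε)) m n
           (ℕ.m⊔n≤o⇒m≤o M N M⊔N≤m) (ℕ.m⊔n≤o⇒m≤o M N M⊔N≤n))
         (proj₂ (ct (½ * ε) (half-pos 0<ε)) m n
           (ℕ.m⊔n≤o⇒n≤o M N M⊔N≤m) (ℕ.m⊔n≤o⇒n≤o M N M⊔N≤n)) ⟩
      ½ * ε + ½ * ε
    ≡⟨ half+half ε ⟩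
      ε ∎
    where
    open ≤-Reasoning
    M = proj₁ (cs (½ * ε) (half-pos 0<ε))
    N = proj₁ (ct (½ * ε) (half-pos 0<ε))
    rearrange : ∀ a b c d → (a + b) - (c + d) ≡ (a - c) + (b - d)
    rearrange = solve 4 (λ a b c d →
      (a :+ b) :+ (:- (c :+ d)) := (a :+ (:- c)) :+ (b :+ (:- d))) refl
      where open +-*-Solver

  eventually-bounded : ∀ {s} → IsCauchy s →
    ∃[ B ] (Positive B × ∃[ N ] (∀ n → N ℕ.≤ n → ∣ s n ∣ < B))
  eventually-bounded {s} cs =
      1ℚ + ∣ s N ∣
    , pos+nonNeg⇒pos 1ℚ ∣ s N ∣ {{∣-∣-nonNeg (s N)}}
    , N
    , λ n N≤n → begin-strict
        ∣ s n ∣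
      ≡⟨ cong ∣_∣ (split (s n) (s N)) ⟩
        ∣ (s n - s N) + s N ∣
      ≤⟨ ∣p+q∣≤∣p∣+∣q∣ (s n - s N) (s N) ⟩
        ∣ s n - s N ∣ + ∣ s N ∣
      <⟨ +-monoˡ-< ∣ s N ∣
           (proj₂ (cs 1ℚ (positive⁻¹ 1ℚ)) n N N≤n ℕ.≤-refl) ⟩
        1ℚ + ∣ s N ∣ ∎
    where
    open ≤-Reasoning
    N = proj₁ (cs 1ℚ (positive⁻¹ 1ℚ))
    split : ∀ a b → a ≡ (a - b) + b
    split = solve 2 (λ a b → a := (a :+ (:- b)) :+ b) refl
      where open +-*-Solver

  *-mono-bound : ∀ {a b B δ} → Positive B → ∣ a ∣ < B → ∣ b ∣ < δ →
    ∣ a * b ∣ ≤ B * δ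
  *-mono-bound {a} {b} {B} {δ} B>0 a<B b<δ = begin
      ∣ a * b ∣
    ≡⟨ ∣p*q∣≡∣p∣*∣q∣ a b ⟩
      ∣ a ∣ * ∣ b ∣
    ≤⟨ *-monoʳ-≤-nonNeg ∣ b ∣ {{∣-∣-nonNeg b}} (<⇒≤ a<B) ⟩
      B * ∣ b ∣
    ≤⟨ *-monoˡ-≤-nonNeg B {{pos⇒nonNeg B {{B>0}}}} (<⇒≤ b<δ) ⟩
      B * δ ∎
    where open ≤-Reasoning

  scale : ∀ {C ε} → Positive C → 0ℚ < ε → ∃[ δ ] (0ℚ < δ × C * δ ≡ ε)
  scale {C} {ε} C>0 0<ε = 1/C * ε , 0<δ , Cδ≡ε
    where
    instance
      C-pos : Positive C
      C-pos = C>0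
      C≢0 : NonZero C
      C≢0 = pos⇒nonZero C
    1/C = 1/ C
    0<δ : 0ℚ < 1/C * ε
    0<δ = subst (_< 1/C * ε) (*-zeroʳ 1/C)
      (*-monoʳ-<-pos 1/C {{1/pos⇒pos C}} 0<ε)
    Cδ≡ε : C * (1/C * ε) ≡ ε
    Cδ≡ε = trans (sym (*-assoc C 1/C ε))
      (trans (cong (_* ε) (*-inverseʳ C)) (*-identityˡ ε))

  half-< : ∀ {ε} → 0ℚ < ε → ½ * ε < ε
  half-< {ε} 0<ε = begin-strict
      ½ * ε
    ≡⟨ sym (+-identityʳ (½ * ε)) ⟩
      ½ * ε + 0ℚ
    <⟨ +-monoʳ-< (½ * ε) (half-pos 0<ε) ⟩
      ½ * ε + ½ * ε
    ≡⟨ half+half ε ⟩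
      ε ∎
    where open ≤-Reasoning

  product-close : ∀ {A B δ} a b c d → Positive A → Positive B →
    ∣ a ∣ < A → ∣ d ∣ < B → ∣ a - c ∣ < δ → ∣ b - d ∣ < δ →
    ∣ a * b - c * d ∣ ≤ (A + B) * δ
  product-close {A} {B} {δ} a b c d A>0 B>0 a<A d<B a≈c b≈d = begin
      ∣ a * b - c * d ∣
    ≡⟨ cong ∣_∣ (rearrange a b c d) ⟩
      ∣ a * (b - d) + d * (a - c) ∣
    ≤⟨ ∣p+q∣≤∣p∣+∣q∣ (a * (b - d)) (d * (a - c)) ⟩
      ∣ a * (b - d) ∣ + ∣ d * (a - c) ∣
    ≤⟨ +-mono-≤ (*-mono-bound {a} {b - d} A>0 a<A b≈d)
                (*-mono-bound {d} {a - c} B>0 d<B a≈c) ⟩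
      A * δ + B * δ
    ≡⟨ sym (*-distribʳ-+ δ A B) ⟩
      (A + B) * δ ∎
    where
    open ≤-Reasoning
    rearrange : ∀ a b c d → a * b - c * d ≡ a * (b - d) + d * (a - c)
    rearrange = solve 4 (λ a b c d →
      a :* b :+ (:- (c :* d)) := a :* (b :+ (:- d)) :+ d :* (a :+ (:- c))) refl
      where open +-*-Solver

  *-cauchy : ∀ {s t} → IsCauchy s → IsCauchy t → IsCauchy (λ n → s n * t n)
  *-cauchy {s} {t} cs ct ε 0<ε =
    assemble (eventually-bounded {s} cs) (eventually-bounded {t} ct)
    where
    assemble :
      ∃[ A ] (Positive A × ∃[ K ] (∀ n → K ℕ.≤ n → ∣ s n ∣ < A)) →
      ∃[ B ] (Positive B × ∃[ L ] (∀ n → L ℕ.≤ n → ∣ t n ∣ < B)) →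
      ∃[ P ] (∀ m n → P ℕ.≤ m → P ℕ.≤ n → ∣ s m * t m - s n * t n ∣ < ε)
    assemble (A , A>0 , K , s<A) (B , B>0 , L , t<B) =
      rescale (scale {A + B} {½ * ε} (pos+pos⇒pos A {{A>0}} B {{B>0}}) (half-pos 0<ε))
      where
      rescale : ∃[ δ ] (0ℚ < δ × (A + B) * δ ≡ ½ * ε) →
        ∃[ P ] (∀ m n → P ℕ.≤ m → P ℕ.≤ n → ∣ s m * t m - s n * t n ∣ < ε)
      rescale (δ , 0<δ , Cδ≡½ε) = (K ℕ.⊔ L) ℕ.⊔ (M ℕ.⊔ N) , close
        where
        M = proj₁ (cs δ 0<δ)
        N = proj₁ (ct δ 0<δ)
        close : ∀ m n →
          (K ℕ.⊔ L) ℕ.⊔ (M ℕ.⊔ N) ℕ.≤ m → (K ℕ.⊔ L) ℕ.⊔ (M ℕ.⊔ N) ℕ.≤ n →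
          ∣ s m * t m - s n * t n ∣ < ε
        close m n p q = ≤-<-trans
          (product-close {A} {B} {δ} (s m) (t m) (s n) (t n) A>0 B>0
            (s<A m (ℕ.m⊔n≤o⇒m≤o K L KL≤m))
            (t<B n (ℕ.m⊔n≤o⇒n≤o K L KL≤n))
            (proj₂ (cs δ 0<δ) m n (ℕ.m⊔n≤o⇒m≤o M N MN≤m) (ℕ.m⊔n≤o⇒m≤o M N MN≤n))
            (proj₂ (ct δ 0<δ) m n (ℕ.m⊔n≤o⇒n≤o M N MN≤m) (ℕ.m⊔n≤o⇒n≤o M N MN≤n)))
          (subst (_< ε) (sym Cδ≡½ε) (half-< {ε} 0<ε))
          where
          KL≤m = ℕ.m⊔n≤o⇒m≤o (K ℕ.⊔ L) (M ℕ.⊔ N) p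
          KL≤n = ℕ.m⊔n≤o⇒m≤o (K ℕ.⊔ L) (M ℕ.⊔ N) q
          MN≤m = ℕ.m⊔n≤o⇒n≤o (K ℕ.⊔ L) (M ℕ.⊔ N) p
          MN≤n = ℕ.m⊔n≤o⇒n≤o (K ℕ.⊔ L) (M ℕ.⊔ N) q

infixl 6 _+ℝ_
infixl 7 _*ℝ_

_+ℝ_ : ℝ → ℝ → ℝ
x +ℝ y = mkℝ (λ n → seq x n + seq y n)
  (+-cauchy {seq x} {seq y} (cauchy x) (cauchy y))

_*ℝ_ : ℝ → ℝ → ℝ
x *ℝ y = mkℝ (λ n → seq x n * seq y n)
  (*-cauchy {seq x} {seq y} (cauchy x) (cauchy y))

{-# OPTIONS --safe #-}
module Submission where

-- Put x = T(0) and s = 1 − T(1). The equations for m = 1 and for m = n = 2 give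
-- x⁴(x² + s² − x) = 0, which together with s(1 − s) = x² leaves T(0) = T(1) = 0,
-- T(0) = T(1) = ½, or T(0) = 0 and T(1) = 1. In the last case put a = T(2), b = T(3).
-- Then T(2n) = a T(n) + T(n − 1) and T(2n − 1) = T(n) + (b − a) T(n − 1), so a and b
-- determine T, and the equations for 3·3, 3·5 and 3·6 force b = 2a, a(a − 1)(a − 3) = 0.
--
-- The case distinctions "x = 0 or x ≠ 0" are not constructive, so this argument only
-- shows that it is not false that T is one of the five sequences. But the equality of
-- reals is stable under double negation, and the five sequences are told apart by the
-- rational values T(1) and T(2), for which an approximation suffices: it rules out all
-- but one of the five, and the remaining one then holds by stability.

open import Algebra.Bundles using (CommutativeRing)
open import Algebra.Solver.Ring.AlmostCommutativeRing
  using (_-Raw-AlmostCommutative⟶_; fromCommutativeRing)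
open import Data.Fin.Patterns using (0F; 1F; 2F; 3F; 4F; 5F; 6F)
open import Data.Integer as ℤ using (ℤ; +_)
import Data.Integer.Properties as ℤ
open import Data.Maybe using (Maybe; just; nothing)
open import Data.Nat as ℕ using (ℕ; zero; suc; z≤n; s≤s; ⌊_/2⌋; ⌈_/2⌉)
open import Data.Nat.Induction using (<-rec)
import Data.Nat.Properties as ℕ
open import Data.Nat.Solver using () renaming (module +-*-Solver to ℕ-Solver)
open import Data.Product using (∃-syntax; _×_; _,_; proj₁; proj₂)
open import Data.Rational as ℚ using (ℚ; 0ℚ; 1ℚ; ½; ∣_∣)
import Data.Rational.Properties as ℚ
open import Data.Rational.Solver using () renaming (module +-*-Solver to ℚ-Solver)
import Data.Rational.Unnormalised as ℚᵘ
import Data.Rational.Unnormalised.Properties as ℚᵘ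
open import Data.Sum as Sum using (_⊎_; inj₁; inj₂; [_,_])
open import Data.Vec using (Vec; []; _∷_)
open import Defs
open import Function using (_∘_; id)
open import Function.Bundles using (_⇔_; mk⇔)
open import Level using (0ℓ; _⊔_) renaming (suc to lsuc)
open import Relation.Binary.PropositionalEquality as ≡ using (_≡_; _≢_)
open import Relation.Nullary using (¬_; yes; no; contradiction)
open import Relation.Nullary.Decidable using (¬¬-excluded-middle)
open import Relation.Nullary.Negation using (Stable; ¬¬-map)

-- Solutions with natural number values

even-or-odd : ∀ n → ∃[ k ] (n ≡ 2 ℕ.* k ⊎ n ≡ suc (2 ℕ.* k))
even-or-odd zero = 0 , inj₁ ≡.refl
even-or-odd (suc n) with even-or-odd n
... | k , inj₁ n≡2k = k , inj₂ (≡.cong suc n≡2k)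
... | k , inj₂ n≡1+2k = suc k , inj₁ (≡.trans (≡.cong suc n≡1+2k) (≡.sym (ℕ.*-suc 2 k)))

residue : ∀ n → ∃[ k ] (n ≡ 3 ℕ.* k ⊎ n ≡ 3 ℕ.* k ℕ.+ 1 ⊎ n ≡ 3 ℕ.* k ℕ.+ 2)
residue 0 = 0 , inj₁ ≡.refl
residue 1 = 0 , inj₂ (inj₁ ≡.refl)
residue 2 = 0 , inj₂ (inj₂ ≡.refl)
residue (suc (suc (suc n))) with residue n
... | k , inj₁ ≡.refl = suc k , inj₁ (≡.sym (ℕ.*-suc 3 k))
... | k , inj₂ (inj₁ ≡.refl) = suc k , inj₂ (inj₁ (≡.cong (ℕ._+ 1) (≡.sym (ℕ.*-suc 3 k))))
... | k , inj₂ (inj₂ ≡.refl) = suc k , inj₂ (inj₂ (≡.cong (ℕ._+ 2) (≡.sym (ℕ.*-suc 3 k))))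

-- Normalisation by the gcd blocks reduction for variable `m`, `n`; the unnormalised rationals
-- compute directly.
fromℕ-+ : ∀ m n → + (m ℕ.+ n) ℚ./ 1 ≡ (+ m ℚ./ 1) ℚ.+ (+ n ℚ./ 1)
fromℕ-+ m n = ℚ.toℚᵘ-injective (begin
  ℚ.toℚᵘ (+ (m ℕ.+ n) ℚ./ 1)                   ≈⟨ ℚ.toℚᵘ-fromℚᵘ (+ (m ℕ.+ n) ℚᵘ./ 1) ⟩
  + (m ℕ.+ n) ℚᵘ./ 1                            ≡⟨ ≡.cong (ℚᵘ._/ 1) (≡.cong₂ ℤ._+_ (ℤ.*-identityʳ (+ m)) (ℤ.*-identityʳ (+ n))) ⟨
  (+ m ℚᵘ./ 1) ℚᵘ.+ (+ n ℚᵘ./ 1)                  ≈⟨ ℚᵘ.+-cong (ℚ.toℚᵘ-fromℚᵘ (+ m ℚᵘ./ 1)) (ℚ.toℚᵘ-fromℚᵘ (+ n ℚᵘ./ 1)) ⟨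
  ℚ.toℚᵘ (+ m ℚ./ 1) ℚᵘ.+ ℚ.toℚᵘ (+ n ℚ./ 1)    ≈⟨ ℚ.toℚᵘ-homo-+ (+ m ℚ./ 1) (+ n ℚ./ 1) ⟨
  ℚ.toℚᵘ ((+ m ℚ./ 1) ℚ.+ (+ n ℚ./ 1))          ∎)
  where open ℚᵘ.≃-Reasoning

fromℕ-* : ∀ m n → + (m ℕ.* n) ℚ./ 1 ≡ (+ m ℚ./ 1) ℚ.* (+ n ℚ./ 1)
fromℕ-* m n = ℚ.toℚᵘ-injective (begin
  ℚ.toℚᵘ (+ (m ℕ.* n) ℚ./ 1)                   ≈⟨ ℚ.toℚᵘ-fromℚᵘ (+ (m ℕ.* n) ℚᵘ./ 1) ⟩
  + (m ℕ.* n) ℚᵘ./ 1                            ≡⟨ ≡.cong (ℚᵘ._/ 1) (ℤ.pos-* m n) ⟩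
  (+ m ℚᵘ./ 1) ℚᵘ.* (+ n ℚᵘ./ 1)                  ≈⟨ ℚᵘ.*-cong (ℚ.toℚᵘ-fromℚᵘ (+ m ℚᵘ./ 1)) (ℚ.toℚᵘ-fromℚᵘ (+ n ℚᵘ./ 1)) ⟨
  ℚ.toℚᵘ (+ m ℚ./ 1) ℚᵘ.* ℚ.toℚᵘ (+ n ℚ./ 1)    ≈⟨ ℚ.toℚᵘ-homo-* (+ m ℚ./ 1) (+ n ℚ./ 1) ⟨
  ℚ.toℚᵘ ((+ m ℚ./ 1) ℚ.* (+ n ℚ./ 1))          ∎)
  where open ℚᵘ.≃-Reasoning

-- Shifting both arguments by one absorbs the conditions `m`, `n` ≥ 1 and avoids truncated
-- subtraction.
ℕ-FunctionalEquation : (ℕ → ℕ) → Set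
ℕ-FunctionalEquation f = ∀ m n →
  f (suc m ℕ.* suc n) ≡ f (suc m) ℕ.* f (suc n) ℕ.+ f m ℕ.* f n

⌈2*n+m/2⌉ : ∀ n m → ⌈ 2 ℕ.* n ℕ.+ m /2⌉ ≡ n ℕ.+ ⌈ m /2⌉
⌈2*n+m/2⌉ zero m = ≡.refl
⌈2*n+m/2⌉ (suc n) m = ≡.trans
  (≡.cong (λ l → ⌈ l ℕ.+ m /2⌉) (ℕ.*-suc 2 n)) (≡.cong suc (⌈2*n+m/2⌉ n m))

⌈2*n/2⌉ : ∀ n → ⌈ 2 ℕ.* n /2⌉ ≡ n
⌈2*n/2⌉ n = ≡.trans (≡.cong (λ l → ⌈ n ℕ.+ l /2⌉) (ℕ.+-identityʳ n)) (≡.sym (ℕ.n≡⌈n+n/2⌉ n))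

⌈1+2*n/2⌉ : ∀ n → ⌈ suc (2 ℕ.* n) /2⌉ ≡ suc n
⌈1+2*n/2⌉ n = ≡.cong suc (≡.trans (≡.cong (λ l → ⌊ n ℕ.+ l /2⌋) (ℕ.+-identityʳ n)) (≡.sym (ℕ.n≡⌊n+n/2⌋ n)))

⌈2*n-1/2⌉ : ∀ n → ⌈ 2 ℕ.* suc n ℕ.∸ 1 /2⌉ ≡ suc n
⌈2*n-1/2⌉ n = ≡.trans (≡.cong ⌈_/2⌉ (ℕ.+-suc n (n ℕ.+ 0))) (⌈1+2*n/2⌉ n)

⌈n/2⌉+⌈n-1/2⌉ : ∀ n → ⌈ suc n /2⌉ ℕ.+ ⌈ n /2⌉ ≡ suc n
⌈n/2⌉+⌈n-1/2⌉ n = ≡.trans (ℕ.+-comm ⌈ suc n /2⌉ ⌈ n /2⌉) (ℕ.⌊n/2⌋+⌈n/2⌉≡n (suc n))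

-- Induction on `m` in steps of two. Such a step adds 2(n + 1) to the product, hence n + 1 to the
-- left side; on the right both left factors grow by one, which adds ⌈(n + 1)/2⌉ + ⌈n/2⌉ = n + 1.
⌈/2⌉-fe : ℕ-FunctionalEquation ⌈_/2⌉
⌈/2⌉-fe zero n = ≡.trans (≡.cong ⌈_/2⌉ (ℕ.+-identityʳ (suc n)))
  (≡.sym (≡.trans (ℕ.+-identityʳ _) (ℕ.+-identityʳ _)))
⌈/2⌉-fe (suc zero) n = ≡.trans (⌈2*n/2⌉ (suc n)) (≡.trans (≡.sym (⌈n/2⌉+⌈n-1/2⌉ n))
  (≡.sym (≡.cong₂ ℕ._+_ (ℕ.*-identityˡ ⌈ suc n /2⌉) (ℕ.*-identityˡ ⌈ n /2⌉))))
⌈/2⌉-fe (suc (suc m)) n = begin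
  ⌈ (2 ℕ.+ suc m) ℕ.* suc n /2⌉                   ≡⟨ ≡.cong ⌈_/2⌉ (ℕ.*-distribʳ-+ (suc n) 2 (suc m)) ⟩
  ⌈ 2 ℕ.* suc n ℕ.+ suc m ℕ.* suc n /2⌉           ≡⟨ ⌈2*n+m/2⌉ (suc n) (suc m ℕ.* suc n) ⟩
  suc n ℕ.+ ⌈ suc m ℕ.* suc n /2⌉                 ≡⟨ ≡.cong₂ ℕ._+_ (≡.sym (⌈n/2⌉+⌈n-1/2⌉ n)) (⌈/2⌉-fe m n) ⟩
  (p ℕ.+ q) ℕ.+ (⌈ suc m /2⌉ ℕ.* p ℕ.+ ⌈ m /2⌉ ℕ.* q) ≡⟨ regroup p q (⌈ suc m /2⌉ ℕ.* p) (⌈ m /2⌉ ℕ.* q) ⟩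
  suc ⌈ suc m /2⌉ ℕ.* p ℕ.+ suc ⌈ m /2⌉ ℕ.* q     ∎
  where
  open ≡.≡-Reasoning
  p = ⌈ suc n /2⌉
  q = ⌈ n /2⌉
  regroup : ∀ a b c d → (a ℕ.+ b) ℕ.+ (c ℕ.+ d) ≡ (a ℕ.+ c) ℕ.+ (b ℕ.+ d)
  regroup = solve 4 (λ a b c d → (a :+ b) :+ (c :+ d) := (a :+ c) :+ (b :+ d)) ≡.refl
    where open ℕ-Solver

-- The indicator of the class of 1 modulo 3, not the Dirichlet character, which is -1 at 2.
χ₃ : ℕ → ℕ
χ₃ 0 = 0
χ₃ 1 = 1
χ₃ 2 = 0
χ₃ (suc (suc (suc n))) = χ₃ n

χ₃-3*+ : ∀ k n → χ₃ (3 ℕ.* k ℕ.+ n) ≡ χ₃ n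
χ₃-3*+ zero n = ≡.refl
χ₃-3*+ (suc k) n = ≡.trans (≡.cong (λ l → χ₃ (l ℕ.+ n)) (ℕ.*-suc 3 k)) (χ₃-3*+ k n)

χ₃-3* : ∀ k → χ₃ (3 ℕ.* k) ≡ 0
χ₃-3* k = ≡.trans (≡.cong χ₃ (≡.sym (ℕ.+-identityʳ (3 ℕ.* k)))) (χ₃-3*+ k 0)

χ₃-2* : ∀ n → χ₃ (2 ℕ.* suc n) ≡ χ₃ n
χ₃-2* 0 = ≡.refl
χ₃-2* 1 = ≡.refl
χ₃-2* 2 = ≡.refl
χ₃-2* (suc (suc (suc n))) =
  ≡.trans (≡.cong χ₃ (ℕ.*-distribˡ-+ 2 3 (suc n))) (χ₃-2* n)

-- Both sides have period 3 in `m`, so the factors 1, 2 and 3 suffice. For the factor 2, doubling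
-- takes n + 1 to the class of 1 exactly when n is in that class.
χ₃-fe : ℕ-FunctionalEquation χ₃
χ₃-fe 0 n = ≡.trans (≡.cong χ₃ (ℕ.+-identityʳ (suc n)))
  (≡.sym (≡.trans (ℕ.+-identityʳ _) (ℕ.+-identityʳ _)))
χ₃-fe 1 n = ≡.trans (χ₃-2* n) (≡.sym (ℕ.+-identityʳ (χ₃ n)))
χ₃-fe 2 n = χ₃-3* (suc n)
χ₃-fe (suc (suc (suc m))) n = ≡.trans (≡.cong χ₃ (ℕ.*-distribʳ-+ (suc n) 3 (suc m)))
  (≡.trans (χ₃-3*+ (suc n) (suc m ℕ.* suc n)) (χ₃-fe m n))

triangle : ℕ → ℕ
triangle zero = 0
triangle (suc n) = suc n ℕ.+ triangle n

2*triangle : ∀ n → 2 ℕ.* triangle n ≡ n ℕ.* (n ℕ.+ 1)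
2*triangle zero = ≡.refl
2*triangle (suc n) = ≡.trans (ℕ.*-distribˡ-+ 2 (suc n) (triangle n))
  (≡.trans (≡.cong (2 ℕ.* suc n ℕ.+_) (2*triangle n))
    (solve 1 (λ n → con 2 :* (con 1 :+ n) :+ n :* (n :+ con 1)
                 := (con 1 :+ n) :* ((con 1 :+ n) :+ con 1)) ≡.refl n))
  where open ℕ-Solver

-- Multiplying by 4 clears the halves on both sides and leaves a polynomial identity: with M = m + 1
-- and N = n + 1 it is MN((M + 1)(N + 1) + (M - 1)(N - 1)) = 2MN(MN + 1).
triangle-fe : ℕ-FunctionalEquation triangle
triangle-fe m n = ℕ.*-cancelˡ-≡ _ _ 4 (begin
  4 ℕ.* triangle (suc m ℕ.* suc n)
    ≡⟨ ℕ.*-assoc 2 2 (triangle (suc m ℕ.* suc n)) ⟩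
  2 ℕ.* (2 ℕ.* triangle (suc m ℕ.* suc n))
    ≡⟨ ≡.cong (2 ℕ.*_) (2*triangle (suc m ℕ.* suc n)) ⟩
  2 ℕ.* (suc m ℕ.* suc n ℕ.* (suc m ℕ.* suc n ℕ.+ 1))
    ≡⟨ solve 2 (λ m n → let M = con 1 :+ m; N = con 1 :+ n in
         con 2 :* (M :* N :* (M :* N :+ con 1))
           := M :* (M :+ con 1) :* (N :* (N :+ con 1)) :+ m :* (m :+ con 1) :* (n :* (n :+ con 1)))
         ≡.refl m n ⟩
  suc m ℕ.* (suc m ℕ.+ 1) ℕ.* (suc n ℕ.* (suc n ℕ.+ 1)) ℕ.+ m ℕ.* (m ℕ.+ 1) ℕ.* (n ℕ.* (n ℕ.+ 1))
    ≡⟨ ≡.cong₂ ℕ._+_ (≡.cong₂ ℕ._*_ (2*triangle (suc m)) (2*triangle (suc n)))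
                     (≡.cong₂ ℕ._*_ (2*triangle m) (2*triangle n)) ⟨
  2 ℕ.* triangle (suc m) ℕ.* (2 ℕ.* triangle (suc n)) ℕ.+ 2 ℕ.* triangle m ℕ.* (2 ℕ.* triangle n)
    ≡⟨ solve 4 (λ a b c d → con 2 :* a :* (con 2 :* b) :+ con 2 :* c :* (con 2 :* d)
                         := con 4 :* (a :* b :+ c :* d)) ≡.refl
         (triangle (suc m)) (triangle (suc n)) (triangle m) (triangle n) ⟩
  4 ℕ.* (triangle (suc m) ℕ.* triangle (suc n) ℕ.+ triangle m ℕ.* triangle n) ∎)
  where
  open ≡.≡-Reasoning
  open ℕ-Solver

-- Classification up to double negation

-- `integral` is doubly negated because one cannot decide constructively which factor of a vanishing
-- product of reals vanishes. The rationals embed so that they can serve as polynomial coefficients.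
record StableDomain c ℓ : Set (lsuc (c ⊔ ℓ)) where
  field
    commutativeRing : CommutativeRing c ℓ
  open CommutativeRing commutativeRing public
  field
    embedding : ℚ.+-*-rawRing -Raw-AlmostCommutative⟶ fromCommutativeRing commutativeRing
    1≉0       : ¬ (1# ≈ 0#)
    ≈-stable  : ∀ {x y} → Stable (x ≈ y)
    integral  : ∀ {x y} → x * y ≈ 0# → ¬ ¬ (x ≈ 0# ⊎ y ≈ 0#)

  open _-Raw-AlmostCommutative⟶_ embedding public
    using () renaming
    (⟦_⟧ to ι; +-homo to ι-+; *-homo to ι-*; 0-homo to ι-0; 1-homo to ι-1)

module Classification {c ℓ} (D : StableDomain c ℓ) where
  open StableDomain D

  private
    coefficient≟ : ∀ p q → Maybe (ι p ≈ ι q)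
    coefficient≟ p q with p ℚ.≟ q
    ... | yes p≡q = just (reflexive (≡.cong ι p≡q))
    ... | no  _   = nothing

  open import Algebra.Solver.Ring ℚ.+-*-rawRing (fromCommutativeRing commutativeRing)
    embedding coefficient≟ using
    (Polynomial; con; var; _:+_; _:*_; _:-_; :-_; prove; ⟦_⟧; ⟦_⟧↓)
  open import Algebra.Properties.Ring ring using (x∙y⁻¹≈ε⇒x≈y; x≈y⇒x∙y⁻¹≈ε)

  FunctionalEquation : (ℕ → Carrier) → Set ℓ
  FunctionalEquation T = ∀ m n →
    T (suc m ℕ.* suc n) ≈ T (suc m) * T (suc n) + T m * T n

  ν : ℕ → Carrier
  ν n = ι (+ n ℚ./ 1)

  -- A record keeps `P` visible in the type, whereas its value at `ρ` would not determine it. The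
  -- polynomials vanishing at `ρ` form an ideal, and `_⊕_` and `_⊛_` build members of it.
  record Vanishes {n} (ρ : Vec Carrier n) (P : Polynomial n) : Set ℓ where
    constructor vanishing
    field value≈0 : ⟦ P ⟧ ρ ≈ 0#

  open Vanishes

  module _ {n} {ρ : Vec Carrier n} where
    infixl 6 _⊕_
    infixl 7 _⊛_

    _⊕_ : ∀ {P Q} → Vanishes ρ P → Vanishes ρ Q → Vanishes ρ (P :+ Q)
    vanishing P≈0 ⊕ vanishing Q≈0 = vanishing (trans (+-cong P≈0 Q≈0) (+-identityˡ 0#))

    _⊛_ : ∀ C {P} → Vanishes ρ P → Vanishes ρ (C :* P)
    C ⊛ vanishing P≈0 = vanishing (trans (*-congˡ P≈0) (zeroʳ (⟦ C ⟧ ρ)))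

    -- Ideal membership by certificate: `Q` is an explicit combination of vanishing polynomials, and
    -- `refl` checks that `P` has the same normal form.
    normalises-to : ∀ {P Q} → Vanishes ρ Q → ⟦ P ⟧↓ ρ ≈ ⟦ Q ⟧↓ ρ → Vanishes ρ P
    normalises-to {P} {Q} (vanishing Q≈0) P↓≈Q↓ = vanishing (trans (prove ρ P Q P↓≈Q↓) Q≈0)

    equal : ∀ P Q → ⟦ P ⟧ ρ ≈ ⟦ Q ⟧ ρ → Vanishes ρ (P :- Q)
    equal P Q P≈Q = vanishing (x≈y⇒x∙y⁻¹≈ε P≈Q)

    equation : ∀ {P Q} → Vanishes ρ (P :- Q) → ⟦ P ⟧ ρ ≈ ⟦ Q ⟧ ρ
    equation (vanishing P-Q≈0) = x∙y⁻¹≈ε⇒x≈y _ _ P-Q≈0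

  -- No inverse of `x` is needed: stability of equality removes the double negation from `integral`.
  cancel : ∀ {x y} → ¬ (x ≈ 0#) → x * y ≈ 0# → y ≈ 0#
  cancel x≉0 xy≈0 = ≈-stable (¬¬-map [ (λ x≈0 → contradiction x≈0 x≉0) , id ] (integral xy≈0))

  -- Consequences of the functional equation at small arguments

  module _ {T : ℕ → Carrier} (fe : FunctionalEquation T) where

    fe-one : ∀ n → T (suc n) ≈ T 1 * T (suc n) + T 0 * T n
    fe-one n = ≡.subst (λ k → T k ≈ T 1 * T (suc n) + T 0 * T n)
      (ℕ.*-identityˡ (suc n)) (fe 0 n)

    -- With s = 1 − T(1), the equations for m = 1 give sⁿ T(n) = T(0)ⁿ⁺¹ for n ≥ 1, so
    -- s⁴ times the equation for m = n = 2 relates s and T(0) alone.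
    initial-values : ¬ ¬ ( (T 0 ≈ 0# × T 1 ≈ 0#)
                         ⊎ (T 0 ≈ ι ½ × T 1 ≈ ι ½)
                         ⊎ (T 0 ≈ 0# × T 1 ≈ 1#))
    initial-values k = ¬¬-excluded-middle λ where
        (yes T0≈0) → integral (value≈0 (y[1-y]≈0 T0≈0)) λ where
          (inj₁ y≈0)   → k (inj₁ (T0≈0 , y≈0))
          (inj₂ 1-y≈0) → k (inj₂ (inj₂
            (T0≈0 , trans (sym (equation {ρ = ρ} {P = con 1ℚ} {Q = Y} (vanishing 1-y≈0))) ι-1)))
        (no T0≉0) → k (inj₂ (inj₁ (equation (x-½≈0 T0≉0) , equation (y-½≈0 T0≉0))))
      where
      ρ : Vec Carrier 5
      ρ = T 0 ∷ T 1 ∷ T 2 ∷ T 3 ∷ T 4 ∷ []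
      X Y T₂ T₃ T₄ S U Q : Polynomial 5
      X = var 0F
      Y = var 1F
      T₂ = var 2F
      T₃ = var 3F
      T₄ = var 4F
      S = con 1ℚ :- Y
      -- The cofactor in (s²T(2))² - x⁶ = (s²T(2) - x³)(s²T(2) + x³); it lets the relation s²T(2) =
      -- x³ be used for the square of T(2).
      U = X :* X :* X :+ S :* S :* T₂
      Q = X :* X :+ S :* S :- X

      e₁ : Vanishes ρ (Y :- (Y :* Y :+ X :* X))
      e₁ = equal _ _ (fe 0 0)
      e₂ : Vanishes ρ (T₂ :- (Y :* T₂ :+ X :* Y))
      e₂ = equal _ _ (fe 0 1)
      e₃ : Vanishes ρ (T₃ :- (Y :* T₃ :+ X :* T₂))
      e₃ = equal _ _ (fe 0 2)
      e₄ : Vanishes ρ (T₄ :- (Y :* T₄ :+ X :* T₃))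
      e₄ = equal _ _ (fe 0 3)
      e₂₂ : Vanishes ρ (T₄ :- (T₂ :* T₂ :+ Y :* Y))
      e₂₂ = equal _ _ (fe 1 1)

      y[1-y]≈0 : T 0 ≈ 0# → Vanishes ρ (Y :* S)
      y[1-y]≈0 T0≈0 = normalises-to (e₁ ⊕ X ⊛ vanishing {P = X} T0≈0) refl

      x⁴q≈0 : Vanishes ρ (X :* (X :* (X :* (X :* Q))))
      x⁴q≈0 = normalises-to
        ( (X :* X :* X :- X :* U :- S :* S :* (X :* X :+ S :* Y)) ⊛ e₁
        ⊕ S :* (X :* X :- U) ⊛ e₂
        ⊕ X :* S :* S ⊛ e₃
        ⊕ S :* S :* S ⊛ e₄
        ⊕ (:- (S :* S :* S :* S)) ⊛ e₂₂ ) refl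

      module _ (T0≉0 : ¬ (T 0 ≈ 0#)) where
        q≈0 : Vanishes ρ Q
        q≈0 = vanishing (cancel T0≉0 (cancel T0≉0 (cancel T0≉0 (cancel T0≉0 (value≈0 x⁴q≈0)))))

        s-x≈0 : Vanishes ρ (S :- X)
        -- `e₁` says s - s² - x² = 0, so its sum with x² + s² - x is s - x. Substituting s = x in
        -- the latter then gives x(2x - 1).
        s-x≈0 = normalises-to (q≈0 ⊕ e₁) refl

        x[2x-1]≈0 : Vanishes ρ (X :* (X :+ X :- con 1ℚ))
        x[2x-1]≈0 = normalises-to (q≈0 ⊕ (:- (S :+ X)) ⊛ s-x≈0) refl

        2x-1≈0 : Vanishes ρ (X :+ X :- con 1ℚ)
        2x-1≈0 = vanishing (cancel T0≉0 (value≈0 x[2x-1]≈0))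

        x-½≈0 : Vanishes ρ (X :- con ½)
        x-½≈0 = normalises-to (con ½ ⊛ 2x-1≈0) refl

        y-½≈0 : Vanishes ρ (Y :- con ½)
        y-½≈0 = normalises-to (con (ℚ.- 1ℚ) ⊛ s-x≈0 ⊕ con (ℚ.- 1ℚ) ⊛ x-½≈0) refl

    zero-solution : T 0 ≈ 0# → T 1 ≈ 0# → ∀ n → T n ≈ 0#
    zero-solution T0≈0 T1≈0 zero = T0≈0
    zero-solution T0≈0 T1≈0 (suc n) = trans (fe-one n) (trans
      (+-cong (trans (*-congʳ T1≈0) (zeroˡ _)) (trans (*-congʳ T0≈0) (zeroˡ _)))
      (+-identityˡ 0#))

    half-solution : T 0 ≈ ι ½ → T 1 ≈ ι ½ → ∀ n → T n ≈ ι ½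
    half-solution T0≈½ T1≈½ zero = T0≈½
    -- Twice T(n + 1) = ½T(n + 1) + ½T(n) reads T(n + 1) = T(n).
    half-solution T0≈½ T1≈½ (suc n) = equation {P = X} {Q = con ½} (normalises-to
        (con (+ 2 ℚ./ 1) ⊛ e₁ ⊕ equal Y (con ½) (half-solution T0≈½ T1≈½ n)) refl)
      where
      ρ = T (suc n) ∷ T n ∷ []
      X Y : Polynomial 2
      X = var 0F
      Y = var 1F
      e₁ : Vanishes ρ (X :- (con ½ :* X :+ con ½ :* Y))
      e₁ = equal _ _ (trans (fe-one n) (+-cong (*-congʳ T1≈½) (*-congʳ T0≈½)))

    module _ (T0≈0 : T 0 ≈ 0#) (T1≈1 : T 1 ≈ 1#) where

      module _ {a} (T2≈a : T 2 ≈ a) where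

        even-step : ∀ n → T (2 ℕ.* suc n) ≈ a * T (suc n) + T n
        even-step n = trans (fe 1 n)
          (+-cong (*-congʳ T2≈a) (trans (*-congʳ T1≈1) (*-identityˡ (T n))))

        -- T(4n) computed as T(4·n) and as T(2·2n).
        odd-step : ∀ {b} → T 3 ≈ b → ∀ n →
          T (suc (2 ℕ.* n)) ≈ T (suc n) + (b - a) * T n
        odd-step {b} T3≈b n = equation {ρ = ρ} {P = Z} {Q = X :+ (B :- A) :* Y} (normalises-to
            ( equal W ((A :* A :+ con 1ℚ) :* X :+ B :* Y) four
            ⊕ con (ℚ.- 1ℚ) ⊛ equal W (A :* V :+ Z) two-two
            ⊕ (:- A) ⊛ equal V (A :* X :+ Y) (even-step n) ) refl)
          where
          ρ = a ∷ b ∷ T (suc n) ∷ T n ∷ T (2 ℕ.* suc n) ∷ T (suc (2 ℕ.* n)) ∷ T (4 ℕ.* suc n) ∷ []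
          A B X Y V Z W : Polynomial 7
          A = var 0F
          B = var 1F
          X = var 2F
          Y = var 3F
          V = var 4F
          Z = var 5F
          W = var 6F
          T4≈a²+1 : T 4 ≈ a * a + ι 1ℚ
          T4≈a²+1 = trans (even-step 1) (+-cong (*-congˡ T2≈a) (trans T1≈1 (sym ι-1)))
          four : T (4 ℕ.* suc n) ≈ (a * a + ι 1ℚ) * T (suc n) + b * T n
          four = trans (fe 3 n) (+-cong (*-congʳ T4≈a²+1) (*-congʳ T3≈b))
          -- The left side is the predecessor of `2 * suc n` in the form to which it reduces.
          pred-2*suc : n ℕ.+ suc (n ℕ.+ 0) ≡ suc (2 ℕ.* n)
          pred-2*suc = ℕ.+-suc n (n ℕ.+ 0)
          two-two : T (4 ℕ.* suc n) ≈ a * T (2 ℕ.* suc n) + T (suc (2 ℕ.* n))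
          two-two = ≡.subst₂ (λ i j → T i ≈ a * T (2 ℕ.* suc n) + T j)
            (≡.sym (ℕ.*-assoc 2 2 (suc n))) pred-2*suc (even-step (n ℕ.+ suc (n ℕ.+ 0)))

      -- The two recurrences express T(4) to T(9) as polynomials in a = T(2) and b = T(3); comparing
      -- two computations of T(9), T(18) and T(15) gives the three relations. `A` and `B` are
      -- arbitrary polynomials so that b can later be replaced by a polynomial in a.
      module _ {n} (ρ : Vec Carrier n) (A B : Polynomial n)
               (T2≈A : T 2 ≈ ⟦ A ⟧ ρ) (T3≈B : T 3 ≈ ⟦ B ⟧ ρ) where
        private
          P₄ P₅ P₆ P₇ P₈ P₉ : Polynomial n
          P₄ = A :* A :+ con 1ℚ
          P₅ = B :+ (B :- A) :* A
          P₆ = A :* B :+ A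
          P₇ = P₄ :+ (B :- A) :* B
          P₈ = A :* P₄ :+ B
          P₉ = P₅ :+ (B :- A) :* P₄

          even : ∀ {k p q} → T (suc k) ≈ p → T k ≈ q → T (2 ℕ.* suc k) ≈ ⟦ A ⟧ ρ * p + q
          even {k} Tk+1≈p Tk≈q = trans (even-step T2≈A k) (+-cong (*-congˡ Tk+1≈p) Tk≈q)

          odd : ∀ {k p q} → T (suc k) ≈ p → T k ≈ q →
            T (suc (2 ℕ.* k)) ≈ p + (⟦ B ⟧ ρ - ⟦ A ⟧ ρ) * q
          odd {k} Tk+1≈p Tk≈q = trans (odd-step T2≈A T3≈B k) (+-cong Tk+1≈p (*-congˡ Tk≈q))

          product : ∀ {k l p q r s} → T (suc k) ≈ p → T (suc l) ≈ q → T k ≈ r → T l ≈ s →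
            T (suc k ℕ.* suc l) ≈ p * q + r * s
          product {k} {l} Tk+1≈p Tl+1≈q Tk≈r Tl≈s =
            trans (fe k l) (+-cong (*-cong Tk+1≈p Tl+1≈q) (*-cong Tk≈r Tl≈s))

          T4≈ : T 4 ≈ ⟦ P₄ ⟧ ρ
          T4≈ = even T2≈A (trans T1≈1 (sym ι-1))
          T5≈ : T 5 ≈ ⟦ P₅ ⟧ ρ
          T5≈ = odd T3≈B T2≈A
          T6≈ : T 6 ≈ ⟦ P₆ ⟧ ρ
          T6≈ = even T3≈B T2≈A
          T7≈ : T 7 ≈ ⟦ P₇ ⟧ ρ
          T7≈ = odd T4≈ T3≈B
          T8≈ : T 8 ≈ ⟦ P₈ ⟧ ρ
          T8≈ = even T4≈ T3≈B
          T9≈ : T 9 ≈ ⟦ P₉ ⟧ ρ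
          T9≈ = odd T5≈ T4≈

        R₃₃≈0 : Vanishes ρ (P₉ :- (B :* B :+ A :* A))
        R₃₃≈0 = equal _ _ (trans (sym T9≈) (product T3≈B T3≈B T2≈A T2≈A))

        R₃₆≈0 : Vanishes ρ (A :* P₉ :+ P₈ :- (B :* P₆ :+ A :* P₅))
        R₃₆≈0 = equal _ _ (trans (sym (even T9≈ T8≈)) (product T3≈B T6≈ T2≈A T5≈))

        R₃₅≈0 : Vanishes ρ (P₈ :+ (B :- A) :* P₇ :- (B :* P₅ :+ A :* P₄))
        R₃₅≈0 = equal _ _ (trans (sym (odd T8≈ T7≈)) (product T3≈B T5≈ T2≈A T4≈))

      -- The relations from 3·3 and 3·6 leave b = 2a or b = 1 + a + 2a². In the second case
      -- those from 3·3 and 3·5 are coprime polynomials in a, with the Bézout cofactors below.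
      ¬¬b-2a≈0 : ¬ ¬ (Vanishes (T 2 ∷ T 3 ∷ []) (var 1F :- con (+ 2 ℚ./ 1) :* var 0F))
      ¬¬b-2a≈0 k = integral (value≈0 product≈0) λ where
          (inj₁ e) → k (vanishing e)
          (inj₂ e) → contradiction
            (unit (equation {ρ = T 2 ∷ T 3 ∷ []} {P = B} {Q = C} (vanishing e))) 1≉0
        where
        A B C : Polynomial 2
        A = var 0F
        B = var 1F
        C = con 1ℚ :+ A :+ con (+ 2 ℚ./ 1) :* A :* A
        product≈0 : Vanishes (T 2 ∷ T 3 ∷ [])
          ((B :- con (+ 2 ℚ./ 1) :* A) :* (B :- C))
        product≈0 = normalises-to
          ((:- (con 1ℚ :+ A)) ⊛ R₃₃≈0 _ A B refl refl ⊕ R₃₆≈0 _ A B refl refl) refl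
        unit : T 3 ≈ ⟦ C ⟧ (T 2 ∷ T 3 ∷ []) → 1# ≈ 0#
        unit T3≈ = trans (sym ι-1) (value≈0 {P = con 1ℚ} (normalises-to
            -- The integer combination below is the constant 224. The arguments of `horner` are
            -- coefficients in ascending degree.
            (con (+ 1 ℚ./ 224) ⊛
              ( horner (+ 178) (ℤ.- + 323) (+ 348) (ℤ.- + 368) (+ 632) (ℤ.- + 856) ⊛ R₃₃≈0 ρ A₁ C₁ refl T3≈
              ⊕ horner (+ 23) (+ 173) (ℤ.- + 56) (ℤ.- + 214) (+ 0) (+ 0) ⊛ R₃₅≈0 ρ A₁ C₁ refl T3≈)) refl))
          where
          ρ : Vec Carrier 1
          ρ = T 2 ∷ []
          A₁ C₁ : Polynomial 1
          A₁ = var 0F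
          C₁ = con 1ℚ :+ A₁ :+ con (+ 2 ℚ./ 1) :* A₁ :* A₁
          int : ℤ → Polynomial 1
          int i = con (i ℚ./ 1)
          horner : (c₀ c₁ c₂ c₃ c₄ c₅ : ℤ) → Polynomial 1
          horner c₀ c₁ c₂ c₃ c₄ c₅ = int c₀ :+ A₁ :* (int c₁ :+ A₁ :* (int c₂ :+
            A₁ :* (int c₃ :+ A₁ :* (int c₄ :+ A₁ :* int c₅))))

      -- With b = 2a the relation from 3·3 alone becomes a³ - 4a² + 3a = 0.
      second-value : T 3 ≈ ι (+ 2 ℚ./ 1) * T 2 →
        Vanishes (T 2 ∷ []) (var 0F :* ((var 0F :- con 1ℚ) :* (var 0F :- con (+ 3 ℚ./ 1))))
      second-value T3≈2a = normalises-to
        (R₃₃≈0 _ (var 0F) (con (+ 2 ℚ./ 1) :* var 0F) refl T3≈2a) refl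

      -- The roots 0, 1 and 3 of the cubic, with b = 2a, are the data of `χ₃`, `⌈_/2⌉` and
      -- `triangle` respectively.
      values-at-2-and-3 : ¬ ¬ ( (T 2 ≈ ν 0 × T 3 ≈ ν 0)
                              ⊎ (T 2 ≈ ν 1 × T 3 ≈ ν 2)
                              ⊎ (T 2 ≈ ν 3 × T 3 ≈ ν 6))
      values-at-2-and-3 k = ¬¬b-2a≈0 λ e →
          let values = value≈0 (second-value (equation e)) in
          integral values λ where
            (inj₁ a≈0) → k (inj₁ (trans a≈0 (sym ι-0) ,
              equation {P = B} {Q = con 0ℚ}
                (normalises-to (e ⊕ con (+ 2 ℚ./ 1) ⊛ vanishing {P = A} a≈0) refl)))
            (inj₂ rest) → integral rest λ where
              (inj₁ a-1≈0) → k (inj₂ (inj₁ (a≈ 1 a-1≈0 ,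
                equation {P = B} {Q = con (+ 2 ℚ./ 1)}
                  (normalises-to (e ⊕ con (+ 2 ℚ./ 1) ⊛ vanishing {P = A :- con 1ℚ} a-1≈0) refl))))
              (inj₂ a-3≈0) → k (inj₂ (inj₂ (a≈ 3 a-3≈0 ,
                equation {P = B} {Q = con (+ 6 ℚ./ 1)}
                  (normalises-to (e ⊕ con (+ 2 ℚ./ 1) ⊛ vanishing {P = A :- con (+ 3 ℚ./ 1)} a-3≈0) refl))))
        where
        A B : Polynomial 2
        A = var 0F
        B = var 1F
        a≈ : ∀ n → T 2 - ν n ≈ 0# → T 2 ≈ ν n
        a≈ n = x∙y⁻¹≈ε⇒x≈y _ _

  -- `even-step` and `odd-step` are recurrences to smaller indices whose coefficients depend only on
  -- the values at 2 and 3.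
  unique : ∀ {S T} → FunctionalEquation S → FunctionalEquation T →
    S 0 ≈ 0# → S 1 ≈ 1# → T 0 ≈ 0# → T 1 ≈ 1# → S 2 ≈ T 2 → S 3 ≈ T 3 →
    ∀ n → S n ≈ T n
  unique {S} {T} feS feT S0≈0 S1≈1 T0≈0 T1≈1 S2≈T2 S3≈T3 = <-rec (λ n → S n ≈ T n) step
    where
    step : ∀ n → (∀ {m} → m ℕ.< n → S m ≈ T m) → S n ≈ T n
    step n rec with even-or-odd n
    ... | zero , inj₁ ≡.refl = trans S0≈0 (sym T0≈0)
    -- Index 1 must be a base case: `odd-step` at 0 refers back to T(1).
    ... | zero , inj₂ ≡.refl = trans S1≈1 (sym T1≈1)
    ... | suc k , inj₁ ≡.refl = trans (even-step feS S0≈0 S1≈1 S2≈T2 k)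
      (trans (+-cong (*-congˡ (rec k+1<n)) (rec (ℕ.<-trans (ℕ.n<1+n k) k+1<n)))
        (sym (even-step feT T0≈0 T1≈1 refl k)))
      where
      k+1<n : suc k ℕ.< 2 ℕ.* suc k
      k+1<n = ℕ.m<m+n (suc k) (s≤s z≤n)
    ... | suc k , inj₂ ≡.refl = trans (odd-step feS S0≈0 S1≈1 S2≈T2 S3≈T3 (suc k))
      (trans (+-cong (rec k+2<n) (*-congˡ (rec (ℕ.<-trans (ℕ.n<1+n (suc k)) k+2<n))))
        (sym (odd-step feT T0≈0 T1≈1 refl refl (suc k))))
      where
      k+2<n : suc (suc k) ℕ.< suc (2 ℕ.* suc k)
      k+2<n = s≤s (ℕ.m<m+n (suc k) (s≤s z≤n))

  -- The five solutions in the abstract domain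

  ν-+ : ∀ m n → ν (m ℕ.+ n) ≈ ν m + ν n
  ν-+ m n = trans (reflexive (≡.cong ι (fromℕ-+ m n))) (ι-+ _ _)

  ν-* : ∀ m n → ν (m ℕ.* n) ≈ ν m * ν n
  ν-* m n = trans (reflexive (≡.cong ι (fromℕ-* m n))) (ι-* _ _)

  fe-resp-≈ : ∀ {S T} → (∀ n → T n ≈ S n) → FunctionalEquation S → FunctionalEquation T
  fe-resp-≈ T≈S feS m n = trans (T≈S _) (trans (feS m n)
    (sym (+-cong (*-cong (T≈S _) (T≈S _)) (*-cong (T≈S _) (T≈S _)))))

  fe-ν : ∀ f → ℕ-FunctionalEquation f → FunctionalEquation (ν ∘ f)
  fe-ν f fe-f m n = trans (reflexive (≡.cong ν (fe-f m n)))
    (trans (ν-+ (f (suc m) ℕ.* f (suc n)) (f m ℕ.* f n))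
      (+-cong (ν-* (f (suc m)) (f (suc n))) (ν-* (f m) (f n))))

  fe-½ : FunctionalEquation (λ _ → ι ½)
  fe-½ _ _ = prove [] (con ½) (con ½ :* con ½ :+ con ½ :* con ½) refl

  -- Each alternative compares T pointwise with a single rational-valued function. This uniform
  -- shape suits both `unique` and the stability argument.
  Solution : (ℕ → Carrier) → Set ℓ
  Solution T = (∀ n → T n ≈ ν 0)
             ⊎ (∀ n → T n ≈ ι ½)
             ⊎ (∀ n → T n ≈ ν ⌈ n /2⌉)
             ⊎ (∀ n → T n ≈ ν (χ₃ n))
             ⊎ (∀ n → T n ≈ ν (triangle n))

  solution⇒fe : ∀ {T} → Solution T → FunctionalEquation T
  solution⇒fe (inj₁ T≈0) = fe-resp-≈ T≈0 (fe-ν (λ _ → 0) λ _ _ → ≡.refl)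
  solution⇒fe (inj₂ (inj₁ T≈½)) = fe-resp-≈ T≈½ fe-½
  solution⇒fe (inj₂ (inj₂ (inj₁ T≈))) = fe-resp-≈ T≈ (fe-ν ⌈_/2⌉ ⌈/2⌉-fe)
  solution⇒fe (inj₂ (inj₂ (inj₂ (inj₁ T≈)))) = fe-resp-≈ T≈ (fe-ν χ₃ χ₃-fe)
  solution⇒fe (inj₂ (inj₂ (inj₂ (inj₂ T≈)))) = fe-resp-≈ T≈ (fe-ν triangle triangle-fe)

  fe⇒¬¬solution : ∀ {T} → FunctionalEquation T → ¬ ¬ Solution T
  fe⇒¬¬solution {T} fe k = initial-values fe λ where
    (inj₁ (T0≈0 , T1≈0)) →
      k (inj₁ λ n → trans (zero-solution fe T0≈0 T1≈0 n) (sym ι-0))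
    (inj₂ (inj₁ (T0≈½ , T1≈½))) → k (inj₂ (inj₁ (half-solution fe T0≈½ T1≈½)))
    (inj₂ (inj₂ (T0≈0 , T1≈1))) → values-at-2-and-3 fe T0≈0 T1≈1 λ where
      (inj₁ (T2≈ , T3≈)) → k (inj₂ (inj₂ (inj₂ (inj₁
        (unique fe (fe-ν χ₃ χ₃-fe) T0≈0 T1≈1 ι-0 ι-1 T2≈ T3≈)))))
      (inj₂ (inj₁ (T2≈ , T3≈))) → k (inj₂ (inj₂ (inj₁
        (unique fe (fe-ν ⌈_/2⌉ ⌈/2⌉-fe) T0≈0 T1≈1 ι-0 ι-1 T2≈ T3≈))))
      (inj₂ (inj₂ (T2≈ , T3≈))) → k (inj₂ (inj₂ (inj₂ (inj₂
        (unique fe (fe-ν triangle triangle-fe) T0≈0 T1≈1 ι-0 ι-1 T2≈ T3≈)))))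

-- The real numbers as a stable domain

Eventually : (ℕ → Set) → Set
Eventually P = ∃[ N ] (∀ n → N ℕ.≤ n → P n)

eventually-map : ∀ {P Q} → (∀ n → P n → Q n) → Eventually P → Eventually Q
eventually-map f (N , p) = N , λ n N≤n → f n (p n N≤n)

eventually-zip : ∀ {P Q R} → (∀ n → P n → Q n → R n) →
  Eventually P → Eventually Q → Eventually R
eventually-zip f (M , p) (N , q) = M ℕ.⊔ N , λ n M⊔N≤n →
  f n (p n (ℕ.m⊔n≤o⇒m≤o M N M⊔N≤n)) (q n (ℕ.m⊔n≤o⇒n≤o M N M⊔N≤n))

eventually-disjoint : ∀ {P Q} → (∀ n → P n → ¬ Q n) → Eventually P → ¬ Eventually Q
eventually-disjoint f p q with N , r ← eventually-zip f p q = r N ℕ.≤-refl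

-- `x ≈ℝ y` unfolds to `Null` of the termwise difference, so facts about null sequences apply to it
-- directly.
Null : (ℕ → ℚ) → Set
Null s = ∀ ε → 0ℚ ℚ.< ε → Eventually λ n → ∣ s n ∣ ℚ.< ε

*-pos : ∀ {p q} → 0ℚ ℚ.< p → 0ℚ ℚ.< q → 0ℚ ℚ.< p ℚ.* q
*-pos {p} {q} 0<p 0<q = ≡.subst (ℚ._< p ℚ.* q) (ℚ.*-zeroʳ p)
  (ℚ.*-monoʳ-<-pos p {{ℚ.positive 0<p}} 0<q)

null-resp : ∀ {s t} → (∀ n → s n ≡ t n) → Null s → Null t
null-resp s≡t null-s ε 0<ε =
  eventually-map (λ n → ≡.subst (λ q → ∣ q ∣ ℚ.< ε) (s≡t n)) (null-s ε 0<ε)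

½+½ : ∀ ε → ½ ℚ.* ε ℚ.+ ½ ℚ.* ε ≡ ε
½+½ = solve 1 (λ ε → con ½ :* ε :+ con ½ :* ε := ε) ≡.refl
  where open ℚ-Solver

null-+ : ∀ {s t} → Null s → Null t → Null (λ n → s n ℚ.+ t n)
null-+ {s} {t} null-s null-t ε 0<ε = eventually-zip
    (λ n ∣s∣<½ε ∣t∣<½ε → ℚ.≤-<-trans (ℚ.∣p+q∣≤∣p∣+∣q∣ (s n) (t n))
      (≡.subst (∣ s n ∣ ℚ.+ ∣ t n ∣ ℚ.<_) (½+½ ε) (ℚ.+-mono-< ∣s∣<½ε ∣t∣<½ε)))
    (null-s (½ ℚ.* ε) 0<½ε) (null-t (½ ℚ.* ε) 0<½ε)
  where
  0<½ε = *-pos (ℚ.positive⁻¹ ½) 0<ε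

∣p∣≤∣p-q∣+∣q∣ : ∀ p q → ∣ p ∣ ℚ.≤ ∣ p ℚ.- q ∣ ℚ.+ ∣ q ∣
∣p∣≤∣p-q∣+∣q∣ p q = ≡.subst (λ r → ∣ r ∣ ℚ.≤ ∣ p ℚ.- q ∣ ℚ.+ ∣ q ∣)
    (telescope p q) (ℚ.∣p+q∣≤∣p∣+∣q∣ (p ℚ.- q) q)
  where
  telescope : ∀ p q → (p ℚ.- q) ℚ.+ q ≡ p
  telescope = solve 2 (λ p q → (p :+ (:- q)) :+ q := p) ≡.refl
    where open ℚ-Solver

Bounded : (ℕ → ℚ) → Set
Bounded s = ∃[ B ] (0ℚ ℚ.< B × Eventually λ n → ∣ s n ∣ ℚ.< B)

cauchy⇒bounded : ∀ {s} → IsCauchy s → Bounded s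
cauchy⇒bounded {s} cauchy-s with N , close ← cauchy-s 1ℚ (ℚ.positive⁻¹ 1ℚ) =
    1ℚ ℚ.+ ∣ s N ∣
  , ℚ.<-≤-trans (ℚ.positive⁻¹ 1ℚ) (ℚ.+-monoʳ-≤ 1ℚ (ℚ.0≤∣p∣ (s N)))
  , N , λ n N≤n → ℚ.≤-<-trans (∣p∣≤∣p-q∣+∣q∣ (s n) (s N))
      (ℚ.+-monoˡ-< ∣ s N ∣ (close n N N≤n ℕ.≤-refl))

∃-quotient : ∀ {p r} → 0ℚ ℚ.< p → 0ℚ ℚ.< r → ∃[ q ] (0ℚ ℚ.< q × p ℚ.* q ≡ r)
∃-quotient {p} {r} 0<p 0<r =
    ℚ.1/ p ℚ.* r
  , *-pos (ℚ.positive⁻¹ (ℚ.1/ p) {{ℚ.1/pos⇒pos p}}) 0<r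
  , ≡.trans (≡.sym (ℚ.*-assoc p (ℚ.1/ p) r))
      (≡.trans (≡.cong (ℚ._* r) (ℚ.*-inverseʳ p)) (ℚ.*-identityˡ r))
  where
  instance
    _ = ℚ.positive 0<p
    _ = ℚ.pos⇒nonZero p

null-* : ∀ {s t} → Bounded s → Null t → Null (λ n → s n ℚ.* t n)
null-* {s} {t} (B , 0<B , s<B) null-t ε 0<ε with δ , 0<δ , Bδ≡ε ← ∃-quotient 0<B 0<ε =
  eventually-zip product<ε s<B (null-t δ 0<δ)
  where
  open ℚ.≤-Reasoning
  product<ε : ∀ n → ∣ s n ∣ ℚ.< B → ∣ t n ∣ ℚ.< δ → ∣ s n ℚ.* t n ∣ ℚ.< ε
  product<ε n s<B t<δ = begin-strict
    ∣ s n ℚ.* t n ∣       ≡⟨ ℚ.∣p*q∣≡∣p∣*∣q∣ (s n) (t n) ⟩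
    ∣ s n ∣ ℚ.* ∣ t n ∣   ≤⟨ ℚ.*-monoʳ-≤-nonNeg ∣ t n ∣ {{ℚ.∣-∣-nonNeg (t n)}} (ℚ.<⇒≤ s<B) ⟩
    B ℚ.* ∣ t n ∣         <⟨ ℚ.*-monoʳ-<-pos B {{ℚ.positive 0<B}} t<δ ⟩
    B ℚ.* δ               ≡⟨ Bδ≡ε ⟩
    ε                     ∎

-1*p≡-p : ∀ p → (ℚ.- 1ℚ) ℚ.* p ≡ ℚ.- p
-1*p≡-p = solve 1 (λ p → con (ℚ.- 1ℚ) :* p := :- p) ≡.refl
  where open ℚ-Solver

-- Ring structure on the reals

infix 8 -ℝ_

-- As a product with -1, negation inherits its Cauchy proof from `_*ℝ_`.
-ℝ_ : ℝ → ℝ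
-ℝ x = fromℚ (ℚ.- 1ℚ) *ℝ x

pointwise⇒≈ℝ : ∀ {x y} → (∀ n → seq x n ≡ seq y n) → x ≈ℝ y
pointwise⇒≈ℝ {x} {y} x≡y ε 0<ε = 0 , λ n _ → ≡.subst (λ q → ∣ q ∣ ℚ.< ε)
  (≡.sym (≡.trans (≡.cong (ℚ._- seq y n) (x≡y n)) (ℚ.+-inverseʳ (seq y n)))) 0<ε

≈ℝ-refl : ∀ {x} → x ≈ℝ x
≈ℝ-refl {x} = pointwise⇒≈ℝ {x} {x} λ _ → ≡.refl

≈ℝ-sym : ∀ {x y} → x ≈ℝ y → y ≈ℝ x
≈ℝ-sym {x} {y} x≈y ε 0<ε = eventually-map
  (λ n → ≡.subst (ℚ._< ε) (≡.trans (≡.sym (ℚ.∣-p∣≡∣p∣ (seq x n ℚ.- seq y n)))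
    (≡.cong ∣_∣ (flip- (seq x n) (seq y n)))))
  (x≈y ε 0<ε)
  where
  flip- : ∀ p q → ℚ.- (p ℚ.- q) ≡ q ℚ.- p
  flip- = solve 2 (λ p q → :- (p :+ (:- q)) := q :+ (:- p)) ≡.refl
    where open ℚ-Solver

≈ℝ-trans : ∀ {x y z} → x ≈ℝ y → y ≈ℝ z → x ≈ℝ z
≈ℝ-trans {x} {y} {z} x≈y y≈z =
  null-resp (λ n → telescope (seq x n) (seq y n) (seq z n)) (null-+ x≈y y≈z)
  where
  telescope : ∀ p q r → (p ℚ.- q) ℚ.+ (q ℚ.- r) ≡ p ℚ.- r
  telescope = solve 3 (λ p q r → (p :+ (:- q)) :+ (q :+ (:- r)) := p :+ (:- r)) ≡.refl
    where open ℚ-Solver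

+ℝ-cong : ∀ {x x′ y y′} → x ≈ℝ x′ → y ≈ℝ y′ → x +ℝ y ≈ℝ x′ +ℝ y′
+ℝ-cong {x} {x′} {y} {y′} x≈x′ y≈y′ =
  null-resp (λ n → regroup (seq x n) (seq x′ n) (seq y n) (seq y′ n)) (null-+ x≈x′ y≈y′)
  where
  regroup : ∀ p p′ q q′ → (p ℚ.- p′) ℚ.+ (q ℚ.- q′) ≡ (p ℚ.+ q) ℚ.- (p′ ℚ.+ q′)
  regroup = solve 4 (λ p p′ q q′ →
    (p :+ (:- p′)) :+ (q :+ (:- q′)) := (p :+ q) :+ (:- (p′ :+ q′))) ≡.refl
    where open ℚ-Solver

*ℝ-cong : ∀ {x x′ y y′} → x ≈ℝ x′ → y ≈ℝ y′ → x *ℝ y ≈ℝ x′ *ℝ y′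
*ℝ-cong {x} {x′} {y} {y′} x≈x′ y≈y′ =
  null-resp (λ n → regroup (seq x n) (seq x′ n) (seq y n) (seq y′ n))
    (null-+ (null-* {seq x} (cauchy⇒bounded {seq x} (cauchy x)) y≈y′)
            (null-* {seq y′} (cauchy⇒bounded {seq y′} (cauchy y′)) x≈x′))
  where
  regroup : ∀ p p′ q q′ →
    p ℚ.* (q ℚ.- q′) ℚ.+ q′ ℚ.* (p ℚ.- p′) ≡ p ℚ.* q ℚ.- p′ ℚ.* q′
  regroup = solve 4 (λ p p′ q q′ →
    p :* (q :+ (:- q′)) :+ q′ :* (p :+ (:- p′)) := p :* q :+ (:- (p′ :* q′))) ≡.refl
    where open ℚ-Solver

ℝ-commutativeRing : CommutativeRing 0ℓ 0ℓ
ℝ-commutativeRing = record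
  { Carrier = ℝ
  ; _≈_ = _≈ℝ_
  ; _+_ = _+ℝ_
  ; _*_ = _*ℝ_
  ; -_ = -ℝ_
  ; 0# = fromℚ 0ℚ
  ; 1# = fromℚ 1ℚ
  ; isCommutativeRing = record
    { isRing = record
      { +-isAbelianGroup = record
        { isGroup = record
          { isMonoid = record
            { isSemigroup = record
              { isMagma = record
                { isEquivalence = record
                  { refl = λ {x} → ≈ℝ-refl {x}
                  ; sym = λ {x} {y} → ≈ℝ-sym {x} {y}
                  ; trans = λ {x} {y} {z} → ≈ℝ-trans {x} {y} {z}
                  }
                ; ∙-cong = λ {x} {x′} {y} {y′} → +ℝ-cong {x} {x′} {y} {y′}
                }
              ; assoc = λ x y z → pointwise⇒≈ℝ {(x +ℝ y) +ℝ z} {x +ℝ (y +ℝ z)}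
                  λ n → ℚ.+-assoc (seq x n) (seq y n) (seq z n)
              }
            ; identity = (λ x → pointwise⇒≈ℝ {fromℚ 0ℚ +ℝ x} {x} λ n → ℚ.+-identityˡ (seq x n))
                       , (λ x → pointwise⇒≈ℝ {x +ℝ fromℚ 0ℚ} {x} λ n → ℚ.+-identityʳ (seq x n))
            }
          ; inverse = (λ x → pointwise⇒≈ℝ { -ℝ x +ℝ x} {fromℚ 0ℚ} λ n → inverseˡ (seq x n))
                    , (λ x → pointwise⇒≈ℝ {x +ℝ -ℝ x} {fromℚ 0ℚ} λ n → inverseʳ (seq x n))
          ; ⁻¹-cong = λ {x} {y} → *ℝ-cong {fromℚ (ℚ.- 1ℚ)} {fromℚ (ℚ.- 1ℚ)} {x} {y}
              (≈ℝ-refl {fromℚ (ℚ.- 1ℚ)})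
          }
        ; comm = λ x y → pointwise⇒≈ℝ {x +ℝ y} {y +ℝ x} λ n → ℚ.+-comm (seq x n) (seq y n)
        }
      ; *-cong = λ {x} {x′} {y} {y′} → *ℝ-cong {x} {x′} {y} {y′}
      ; *-assoc = λ x y z → pointwise⇒≈ℝ {(x *ℝ y) *ℝ z} {x *ℝ (y *ℝ z)}
          λ n → ℚ.*-assoc (seq x n) (seq y n) (seq z n)
      ; *-identity = (λ x → pointwise⇒≈ℝ {fromℚ 1ℚ *ℝ x} {x} λ n → ℚ.*-identityˡ (seq x n))
                   , (λ x → pointwise⇒≈ℝ {x *ℝ fromℚ 1ℚ} {x} λ n → ℚ.*-identityʳ (seq x n))
      ; distrib = (λ x y z → pointwise⇒≈ℝ {x *ℝ (y +ℝ z)} {x *ℝ y +ℝ x *ℝ z}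
                    λ n → ℚ.*-distribˡ-+ (seq x n) (seq y n) (seq z n))
                , (λ x y z → pointwise⇒≈ℝ {(y +ℝ z) *ℝ x} {y *ℝ x +ℝ z *ℝ x}
                    λ n → ℚ.*-distribʳ-+ (seq x n) (seq y n) (seq z n))
      }
    ; *-comm = λ x y → pointwise⇒≈ℝ {x *ℝ y} {y *ℝ x} λ n → ℚ.*-comm (seq x n) (seq y n)
    }
  }
  where
  inverseˡ : ∀ p → (ℚ.- 1ℚ) ℚ.* p ℚ.+ p ≡ 0ℚ
  inverseˡ = solve 1 (λ p → con (ℚ.- 1ℚ) :* p :+ p := con 0ℚ) ≡.refl
    where open ℚ-Solver
  inverseʳ : ∀ p → p ℚ.+ (ℚ.- 1ℚ) ℚ.* p ≡ 0ℚ
  inverseʳ = solve 1 (λ p → p :+ con (ℚ.- 1ℚ) :* p := con 0ℚ) ≡.refl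
    where open ℚ-Solver

fromℚ-embedding : ℚ.+-*-rawRing -Raw-AlmostCommutative⟶ fromCommutativeRing ℝ-commutativeRing
fromℚ-embedding = record
  { ⟦_⟧ = fromℚ
  ; +-homo = λ p q → pointwise⇒≈ℝ {fromℚ (p ℚ.+ q)} {fromℚ p +ℝ fromℚ q} λ _ → ≡.refl
  ; *-homo = λ p q → pointwise⇒≈ℝ {fromℚ (p ℚ.* q)} {fromℚ p *ℝ fromℚ q} λ _ → ≡.refl
  ; -‿homo = λ p → pointwise⇒≈ℝ {fromℚ (ℚ.- p)} { -ℝ fromℚ p} λ _ → ≡.sym (-1*p≡-p p)
  ; 0-homo = ≈ℝ-refl {fromℚ 0ℚ}
  ; 1-homo = ≈ℝ-refl {fromℚ 1ℚ}
  }

-- Past N terms differ by less than δ, and whether the rational ∣s(N)∣ is below 2δ is decidable. If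
-- it is, the tail stays below 3δ; if not, no later term can drop below δ.
locate-3δ : ∀ {s} → IsCauchy s → ∀ {δ} → 0ℚ ℚ.< δ →
  (Eventually λ n → ∣ s n ∣ ℚ.< δ ℚ.+ (δ ℚ.+ δ)) ⊎ (Eventually λ n → δ ℚ.≤ ∣ s n ∣)
locate-3δ {s} cauchy-s {δ} 0<δ with N , close ← cauchy-s δ 0<δ with ∣ s N ∣ ℚ.<? δ ℚ.+ δ
... | yes small = inj₁ (N , λ n N≤n → ℚ.≤-<-trans (∣p∣≤∣p-q∣+∣q∣ (s n) (s N))
  (ℚ.+-mono-< (close n N N≤n ℕ.≤-refl) small))
... | no large = inj₂ (N , λ n N≤n → ℚ.≮⇒≥ λ ∣xₙ∣<δ → large
  (ℚ.≤-<-trans (∣p∣≤∣p-q∣+∣q∣ (s N) (s n))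
    (ℚ.+-mono-< (close N n ℕ.≤-refl N≤n) ∣xₙ∣<δ)))

third : ∀ {ε} → 0ℚ ℚ.< ε → ∃[ δ ] (0ℚ ℚ.< δ × δ ℚ.+ (δ ℚ.+ δ) ≡ ε)
third {ε} 0<ε = ⅓ ℚ.* ε , *-pos (ℚ.positive⁻¹ ⅓) 0<ε , sum≡ε ε
  where
  ⅓ = + 1 ℚ./ 3
  sum≡ε : ∀ ε → ⅓ ℚ.* ε ℚ.+ (⅓ ℚ.* ε ℚ.+ ⅓ ℚ.* ε) ≡ ε
  sum≡ε = solve 1 (λ ε → con ⅓ :* ε :+ (con ⅓ :* ε :+ con ⅓ :* ε) := ε) ≡.refl
    where open ℚ-Solver

locate : ∀ {s} → IsCauchy s → ∀ {ε} → 0ℚ ℚ.< ε →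
  (Eventually λ n → ∣ s n ∣ ℚ.< ε) ⊎ (∃[ δ ] (0ℚ ℚ.< δ × Eventually λ n → δ ℚ.≤ ∣ s n ∣))
locate {s} cauchy-s {ε} 0<ε = rescale (third 0<ε)
  where
  rescale : ∃[ δ ] (0ℚ ℚ.< δ × δ ℚ.+ (δ ℚ.+ δ) ≡ ε) →
    (Eventually λ n → ∣ s n ∣ ℚ.< ε) ⊎ (∃[ δ ] (0ℚ ℚ.< δ × Eventually λ n → δ ℚ.≤ ∣ s n ∣))
  rescale (δ , 0<δ , ≡.refl) = Sum.map₂ (λ large → δ , 0<δ , large) (locate-3δ {s} cauchy-s 0<δ)

null-disjoint : ∀ {s} → Null s → ¬ (∃[ δ ] (0ℚ ℚ.< δ × Eventually λ n → δ ℚ.≤ ∣ s n ∣))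
null-disjoint null-s (δ , 0<δ , large) = eventually-disjoint
  (λ n ∣s∣<δ δ≤∣s∣ → ℚ.<-irrefl ≡.refl (ℚ.<-≤-trans ∣s∣<δ δ≤∣s∣)) (null-s δ 0<δ) large

-- For each ε, `locate` either gives the required bound or bounds the sequence away from zero, and
-- the latter refutes nullity outright.
null-stable : ∀ {s} → IsCauchy s → Stable (Null s)
null-stable {s} cauchy-s ¬¬null ε 0<ε =
  [ id , (λ large → contradiction (λ null-s → null-disjoint {s} null-s large) ¬¬null) ]
    (locate {s} cauchy-s 0<ε)

-- If s were bounded away from zero, dividing by it would make t null, against `k`. So `locate` must
-- return the small alternative for every ε, and s is null.
null-*⇒¬¬null : ∀ {s t} → IsCauchy s → Null (λ n → s n ℚ.* t n) → ¬ ¬ (Null s ⊎ Null t)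
null-*⇒¬¬null {s} {t} cauchy-s null-st k = k (inj₁ null-s)
  where
  null-t : ∀ {δ} → 0ℚ ℚ.< δ → (Eventually λ n → δ ℚ.≤ ∣ s n ∣) → Null t
  null-t {δ} 0<δ large η 0<η = eventually-zip small-t large (null-st (δ ℚ.* η) (*-pos 0<δ 0<η))
    where
    open ℚ.≤-Reasoning
    small-t : ∀ n → δ ℚ.≤ ∣ s n ∣ → ∣ s n ℚ.* t n ∣ ℚ.< δ ℚ.* η → ∣ t n ∣ ℚ.< η
    small-t n δ≤∣s∣ ∣st∣<δη =
      ℚ.*-cancelˡ-<-nonNeg δ {{ℚ.pos⇒nonNeg δ {{ℚ.positive 0<δ}}}} (begin-strict
        δ ℚ.* ∣ t n ∣          ≤⟨ ℚ.*-monoʳ-≤-nonNeg ∣ t n ∣ {{ℚ.∣-∣-nonNeg (t n)}} δ≤∣s∣ ⟩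
        ∣ s n ∣ ℚ.* ∣ t n ∣    ≡⟨ ℚ.∣p*q∣≡∣p∣*∣q∣ (s n) (t n) ⟨
        ∣ s n ℚ.* t n ∣        <⟨ ∣st∣<δη ⟩
        δ ℚ.* η                ∎)
  null-s : Null s
  null-s ε 0<ε = [ id , (λ (δ , 0<δ , large) → contradiction (inj₂ (null-t 0<δ large)) k) ]
    (locate {s} cauchy-s 0<ε)

cauchy-resp : ∀ {s t} → (∀ n → s n ≡ t n) → IsCauchy s → IsCauchy t
cauchy-resp s≡t cauchy-s ε 0<ε with N , close ← cauchy-s ε 0<ε =
  N , λ m n N≤m N≤n → ≡.subst₂ (λ p q → ∣ p ℚ.- q ∣ ℚ.< ε) (s≡t m) (s≡t n) (close m n N≤m N≤n)

cauchy-- : ∀ x y → IsCauchy (λ n → seq x n ℚ.- seq y n)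
cauchy-- x y = cauchy-resp (λ n → ≡.cong (seq x n ℚ.+_) (-1*p≡-p (seq y n))) (cauchy (x +ℝ -ℝ y))

≈ℝ0⇒null : ∀ {x} → x ≈ℝ fromℚ 0ℚ → Null (seq x)
≈ℝ0⇒null {x} = null-resp (λ n → ℚ.+-identityʳ (seq x n))

null⇒≈ℝ0 : ∀ {x} → Null (seq x) → x ≈ℝ fromℚ 0ℚ
null⇒≈ℝ0 {x} = null-resp (λ n → ≡.sym (ℚ.+-identityʳ (seq x n)))

≢⇒0<∣q-p∣ : ∀ {p q} → p ≢ q → 0ℚ ℚ.< ∣ q ℚ.- p ∣
≢⇒0<∣q-p∣ {p} {q} p≢q with 0ℚ ℚ.<? ∣ q ℚ.- p ∣
... | yes 0<d = 0<d
... | no 0≮d = contradiction (≡.sym (x∙y⁻¹≈ε⇒x≈y q p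
    (ℚ.∣p∣≡0⇒p≡0 _ (ℚ.≤-antisym (ℚ.≮⇒≥ 0≮d) (ℚ.0≤∣p∣ _))))) p≢q
  where open import Algebra.Properties.Group ℚ.+-0-group using (x∙y⁻¹≈ε⇒x≈y)

near-or-apart : ∀ x p {ε} → 0ℚ ℚ.< ε →
  (Eventually λ n → ∣ seq x n ℚ.- p ∣ ℚ.< ε) ⊎ ¬ (x ≈ℝ fromℚ p)
near-or-apart x p 0<ε = Sum.map₂ (λ far x≈p → null-disjoint {λ n → seq x n ℚ.- p} x≈p far)
  (locate {λ n → seq x n ℚ.- p} (cauchy-- x (fromℚ p)) 0<ε)

-- The balls of radius ½∣q - p∣ around p and q are disjoint: being eventually in the first excludes
-- q, and being bounded away from p excludes p.
separated : ∀ {p q} → p ≢ q → ∀ x → ¬ (x ≈ℝ fromℚ p) ⊎ ¬ (x ≈ℝ fromℚ q)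
separated {p} {q} p≢q x = Sum.swap (Sum.map₁ near-p⇒≉q (near-or-apart x p 0<½d))
  where
  d : ℚ
  d = ∣ q ℚ.- p ∣
  0<½d : 0ℚ ℚ.< ½ ℚ.* d
  0<½d = *-pos (ℚ.positive⁻¹ ½) (≢⇒0<∣q-p∣ p≢q)
  open ℚ.≤-Reasoning
  cancel-x : ∀ x p q → q ℚ.- p ≡ (x ℚ.- p) ℚ.- (x ℚ.- q)
  cancel-x = solve 3 (λ x p q → q :+ (:- p) := (x :+ (:- p)) :+ (:- (x :+ (:- q)))) ≡.refl
    where open ℚ-Solver
  not-both : ∀ n → ∣ seq x n ℚ.- p ∣ ℚ.< ½ ℚ.* d → ¬ (∣ seq x n ℚ.- q ∣ ℚ.< ½ ℚ.* d)
  not-both n x-p<½d x-q<½d = ℚ.<-irrefl ≡.refl (begin-strict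
    d                                              ≡⟨ ≡.cong ∣_∣ (cancel-x (seq x n) p q) ⟩
    ∣ (seq x n ℚ.- p) ℚ.- (seq x n ℚ.- q) ∣        ≤⟨ ℚ.∣p-q∣≤∣p∣+∣q∣ (seq x n ℚ.- p) (seq x n ℚ.- q) ⟩
    ∣ seq x n ℚ.- p ∣ ℚ.+ ∣ seq x n ℚ.- q ∣        <⟨ ℚ.+-mono-< x-p<½d x-q<½d ⟩
    ½ ℚ.* d ℚ.+ ½ ℚ.* d                            ≡⟨ ½+½ d ⟩
    d                                              ∎)
  near-p⇒≉q : (Eventually λ n → ∣ seq x n ℚ.- p ∣ ℚ.< ½ ℚ.* d) → ¬ (x ≈ℝ fromℚ q)
  near-p⇒≉q near-p x≈q = eventually-disjoint {λ n → ∣ seq x n ℚ.- p ∣ ℚ.< ½ ℚ.* d}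
    {λ n → ∣ seq x n ℚ.- q ∣ ℚ.< ½ ℚ.* d} not-both near-p (x≈q (½ ℚ.* d) 0<½d)

ℝ-domain : StableDomain 0ℓ 0ℓ
ℝ-domain = record
  { commutativeRing = ℝ-commutativeRing
  ; embedding = fromℚ-embedding
  ; 1≉0 = λ 1≈0 → let N , close = 1≈0 1ℚ (ℚ.positive⁻¹ 1ℚ) in ℚ.<-irrefl ≡.refl (close N ℕ.≤-refl)
  ; ≈-stable = λ {x} {y} → null-stable (cauchy-- x y)
  ; integral = λ {x} {y} xy≈0 → ¬¬-map
      [ inj₁ ∘ null⇒≈ℝ0 {x} , inj₂ ∘ null⇒≈ℝ0 {y} ]
      (null-*⇒¬¬null (cauchy x) (≈ℝ0⇒null {x *ℝ y} xy≈0))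
  }

-- Removing the double negation from the classification

open Classification ℝ-domain

-- A disjunction does not inherit stability from its parts in general; knowing which part fails
-- tells which one to prove.
stable-⊎ : ∀ {A B : Set} → Stable A → Stable B → ¬ A ⊎ ¬ B → Stable (A ⊎ B)
stable-⊎ stable-A stable-B (inj₁ ¬A) ¬¬A⊎B =
  inj₂ (stable-B (¬¬-map [ (λ a → contradiction a ¬A) , id ] ¬¬A⊎B))
stable-⊎ stable-A stable-B (inj₂ ¬B) ¬¬A⊎B =
  inj₁ (stable-A (¬¬-map [ id , (λ b → contradiction b ¬B) ] ¬¬A⊎B))

distinguish : ∀ {A B : Set} {p q} → p ≢ q → ∀ x → (A → x ≈ℝ fromℚ p) → (B → x ≈ℝ fromℚ q) → ¬ A ⊎ ¬ B
distinguish p≢q x A⇒x≈p B⇒x≈q = Sum.map (_∘ A⇒x≈p) (_∘ B⇒x≈q) (separated p≢q x)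

¬⊎¬-⊎ : ∀ {A B C : Set} → ¬ A ⊎ ¬ B → ¬ A ⊎ ¬ C → ¬ A ⊎ ¬ (B ⊎ C)
¬⊎¬-⊎ (inj₁ ¬A) _ = inj₁ ¬A
¬⊎¬-⊎ (inj₂ _) (inj₁ ¬A) = inj₁ ¬A
¬⊎¬-⊎ (inj₂ ¬B) (inj₂ ¬C) = inj₂ [ ¬B , ¬C ]

stable-≈ : ∀ (T : ℕ → ℝ) (f : ℕ → ℚ) → Stable (∀ n → T n ≈ℝ fromℚ (f n))
stable-≈ T f ¬¬T≈f n = null-stable (cauchy-- (T n) (fromℚ (f n))) (¬¬-map (λ T≈f → T≈f n) ¬¬T≈f)

-- The values at 1 are 0, ½, 1, 1, 1, which separates every pair except those among the last three;
-- their values at 2 are 1, 0, 3.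
stable-solution : ∀ T → Stable (Solution T)
stable-solution T =
  stable-⊎ (stable-≈ T f₁)
    (stable-⊎ (stable-≈ T f₂)
      (stable-⊎ (stable-≈ T f₃)
        (stable-⊎ (stable-≈ T f₄) (stable-≈ T f₅) (at 2 f₄ f₅ λ ()))
        (¬⊎¬-⊎ (at 2 f₃ f₄ λ ()) (at 2 f₃ f₅ λ ())))
      (¬⊎¬-⊎ (at 1 f₂ f₃ λ ()) (¬⊎¬-⊎ (at 1 f₂ f₄ λ ()) (at 1 f₂ f₅ λ ()))))
    (¬⊎¬-⊎ (at 1 f₁ f₂ λ ())
      (¬⊎¬-⊎ (at 1 f₁ f₃ λ ()) (¬⊎¬-⊎ (at 1 f₁ f₄ λ ()) (at 1 f₁ f₅ λ ()))))
  where
  f₁ f₂ f₃ f₄ f₅ : ℕ → ℚ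
  f₁ _ = + 0 ℚ./ 1
  f₂ _ = ½
  f₃ n = + ⌈ n /2⌉ ℚ./ 1
  f₄ n = + χ₃ n ℚ./ 1
  f₅ n = + triangle n ℚ./ 1
  at : ∀ n (f g : ℕ → ℚ) → f n ≢ g n →
    ¬ (∀ n → T n ≈ℝ fromℚ (f n)) ⊎ ¬ (∀ n → T n ≈ℝ fromℚ (g n))
  at n f g fn≢gn = distinguish fn≢gn (T n) (λ T≈f → T≈f n) (λ T≈g → T≈g n)

-- The five sequences

open import Data.Nat using (_+_; _*_; _∸_; _≤_)

½*n*[n+1]≈triangle : ∀ n → fromℚ ½ *ℝ fromℕ (n * (n + 1)) ≈ℝ fromℕ (triangle n)
½*n*[n+1]≈triangle n = pointwise⇒≈ℝ {fromℚ ½ *ℝ fromℕ (n * (n + 1))} {fromℕ (triangle n)} λ _ → begin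
  ½ ℚ.* (+ (n * (n + 1)) ℚ./ 1)                      ≡⟨ ≡.cong (λ k → ½ ℚ.* (+ k ℚ./ 1)) (2*triangle n) ⟨
  ½ ℚ.* (+ (2 * triangle n) ℚ./ 1)                   ≡⟨ ≡.cong (½ ℚ.*_) (fromℕ-* 2 (triangle n)) ⟩
  ½ ℚ.* ((+ 2 ℚ./ 1) ℚ.* (+ triangle n ℚ./ 1))       ≡⟨ ℚ.*-assoc ½ (+ 2 ℚ./ 1) (+ triangle n ℚ./ 1) ⟨
  1ℚ ℚ.* (+ triangle n ℚ./ 1)                        ≡⟨ ℚ.*-identityˡ (+ triangle n ℚ./ 1) ⟩
  + triangle n ℚ./ 1                                 ∎
  where open ≡.≡-Reasoning

Listed : (ℕ → ℝ) → Set
Listed T = ( (∀ (n : ℕ) → T n ≈ℝ fromℕ 0)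
    ⊎ (∀ (n : ℕ) → T n ≈ℝ fromℚ ½)
    ⊎ ((T 0 ≈ℝ fromℕ 0) ×
    (∀ (n : ℕ) → 1 ≤ n →
    (T (2 * n) ≈ℝ fromℕ n) × (T (2 * n ∸ 1) ≈ℝ fromℕ n)))
    ⊎ (∀ (n : ℕ) →
    (T (3 * n) ≈ℝ fromℕ 0) × (T (3 * n + 2) ≈ℝ fromℕ 0) ×
    (T (3 * n + 1) ≈ℝ fromℕ 1))
    ⊎ (∀ (n : ℕ) → T n ≈ℝ fromℚ ½ *ℝ fromℕ (n * (n + 1))) )

module _ (T : ℕ → ℝ) where
  ⌈/2⌉-listed : (∀ n → T n ≈ℝ fromℕ ⌈ n /2⌉) →
    (T 0 ≈ℝ fromℕ 0) × (∀ n → 1 ≤ n → (T (2 * n) ≈ℝ fromℕ n) × (T (2 * n ∸ 1) ≈ℝ fromℕ n))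
  ⌈/2⌉-listed T≈ = T≈ 0 , λ where
    n@(suc m) 1≤n →
        ≡.subst (λ k → T (2 * n) ≈ℝ fromℕ k) (⌈2*n/2⌉ n) (T≈ (2 * n))
      , ≡.subst (λ k → T (2 * n ∸ 1) ≈ℝ fromℕ k) (⌈2*n-1/2⌉ m) (T≈ (2 * n ∸ 1))

  listed-⌈/2⌉ :
    (T 0 ≈ℝ fromℕ 0) × (∀ n → 1 ≤ n → (T (2 * n) ≈ℝ fromℕ n) × (T (2 * n ∸ 1) ≈ℝ fromℕ n)) →
    ∀ n → T n ≈ℝ fromℕ ⌈ n /2⌉
  listed-⌈/2⌉ (T0≈0 , T≈) n with even-or-odd n
  ... | zero , inj₁ ≡.refl = T0≈0
  ... | suc k , inj₁ ≡.refl = ≡.subst (λ l → T (2 * suc k) ≈ℝ fromℕ l)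
    (≡.sym (⌈2*n/2⌉ (suc k))) (proj₁ (T≈ (suc k) (s≤s z≤n)))
  -- The index 2k + 1 is 2(k + 1) - 1, so the clause for k + 1 applies, also when k = 0.
  ... | k , inj₂ ≡.refl = ≡.subst₂ (λ i l → T i ≈ℝ fromℕ l)
    (ℕ.+-suc k (k + 0)) (≡.sym (⌈1+2*n/2⌉ k)) (proj₂ (T≈ (suc k) (s≤s z≤n)))

  χ₃-listed : (∀ n → T n ≈ℝ fromℕ (χ₃ n)) → ∀ n →
    (T (3 * n) ≈ℝ fromℕ 0) × (T (3 * n + 2) ≈ℝ fromℕ 0) × (T (3 * n + 1) ≈ℝ fromℕ 1)
  χ₃-listed T≈ n =
      ≡.subst (λ k → T (3 * n) ≈ℝ fromℕ k) (χ₃-3* n) (T≈ (3 * n))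
    , ≡.subst (λ k → T (3 * n + 2) ≈ℝ fromℕ k) (χ₃-3*+ n 2) (T≈ (3 * n + 2))
    , ≡.subst (λ k → T (3 * n + 1) ≈ℝ fromℕ k) (χ₃-3*+ n 1) (T≈ (3 * n + 1))

  listed-χ₃ : (∀ n →
    (T (3 * n) ≈ℝ fromℕ 0) × (T (3 * n + 2) ≈ℝ fromℕ 0) × (T (3 * n + 1) ≈ℝ fromℕ 1)) →
    ∀ n → T n ≈ℝ fromℕ (χ₃ n)
  listed-χ₃ T≈ n with residue n
  ... | k , inj₁ ≡.refl = ≡.subst (λ l → T (3 * k) ≈ℝ fromℕ l)
    (≡.sym (χ₃-3* k)) (proj₁ (T≈ k))
  ... | k , inj₂ (inj₁ ≡.refl) = ≡.subst (λ l → T (3 * k + 1) ≈ℝ fromℕ l)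
    (≡.sym (χ₃-3*+ k 1)) (proj₂ (proj₂ (T≈ k)))
  ... | k , inj₂ (inj₂ ≡.refl) = ≡.subst (λ l → T (3 * k + 2) ≈ℝ fromℕ l)
    (≡.sym (χ₃-3*+ k 2)) (proj₁ (proj₂ (T≈ k)))

  listed⇒solution : Listed T → Solution T
  listed⇒solution (inj₁ T≈) = inj₁ T≈
  listed⇒solution (inj₂ (inj₁ T≈)) = inj₂ (inj₁ T≈)
  listed⇒solution (inj₂ (inj₂ (inj₁ T≈))) = inj₂ (inj₂ (inj₁ (listed-⌈/2⌉ T≈)))
  listed⇒solution (inj₂ (inj₂ (inj₂ (inj₁ T≈)))) = inj₂ (inj₂ (inj₂ (inj₁ (listed-χ₃ T≈))))
  listed⇒solution (inj₂ (inj₂ (inj₂ (inj₂ T≈)))) = inj₂ (inj₂ (inj₂ (inj₂ λ n →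
    ≈ℝ-trans {T n} {fromℚ ½ *ℝ fromℕ (n * (n + 1))} {fromℕ (triangle n)} (T≈ n) (½*n*[n+1]≈triangle n))))

  solution⇒listed : Solution T → Listed T
  solution⇒listed (inj₁ T≈) = inj₁ T≈
  solution⇒listed (inj₂ (inj₁ T≈)) = inj₂ (inj₁ T≈)
  solution⇒listed (inj₂ (inj₂ (inj₁ T≈))) = inj₂ (inj₂ (inj₁ (⌈/2⌉-listed T≈)))
  solution⇒listed (inj₂ (inj₂ (inj₂ (inj₁ T≈)))) = inj₂ (inj₂ (inj₂ (inj₁ (χ₃-listed T≈))))
  solution⇒listed (inj₂ (inj₂ (inj₂ (inj₂ T≈)))) = inj₂ (inj₂ (inj₂ (inj₂ λ n →
    ≈ℝ-trans {T n} {fromℕ (triangle n)} {fromℚ ½ *ℝ fromℕ (n * (n + 1))} (T≈ n)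
      (≈ℝ-sym {fromℚ ½ *ℝ fromℕ (n * (n + 1))} {fromℕ (triangle n)} (½*n*[n+1]≈triangle n)))))

theorem1 : (T : ℕ → ℝ) →
    (∀ (m n : ℕ) → 1 ≤ m → 1 ≤ n →
    T (m * n) ≈ℝ T m *ℝ T n +ℝ T (m ∸ 1) *ℝ T (n ∸ 1))
    ⇔
    ( (∀ (n : ℕ) → T n ≈ℝ fromℕ 0)
    ⊎ (∀ (n : ℕ) → T n ≈ℝ fromℚ ½)
    ⊎ ((T 0 ≈ℝ fromℕ 0) ×
    (∀ (n : ℕ) → 1 ≤ n →
    (T (2 * n) ≈ℝ fromℕ n) × (T (2 * n ∸ 1) ≈ℝ fromℕ n)))
    ⊎ (∀ (n : ℕ) →
    (T (3 * n) ≈ℝ fromℕ 0) × (T (3 * n + 2) ≈ℝ fromℕ 0) ×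
    (T (3 * n + 1) ≈ℝ fromℕ 1))
    ⊎ (∀ (n : ℕ) → T n ≈ℝ fromℚ ½ *ℝ fromℕ (n * (n + 1))) )
theorem1 T = mk⇔
  (λ fe → solution⇒listed T (stable-solution T
    (fe⇒¬¬solution {T} λ m n → fe (suc m) (suc n) (s≤s z≤n) (s≤s z≤n))))
  (λ where listed (suc m) (suc n) _ _ → solution⇒fe {T} (listed⇒solution T listed) m n)
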